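{- Let $H\le G$ be finite groups and $\Sigma$ a group of automorphisms of $G$. If the set $\{(\sigma,g)\in\Sigma\times H:\sigma(g)=g\}$ is $4$-large in the direct product group $\Sigma\times H$, then $\sigma(g)=g$ for all $\sigma\in\Sigma$ and $g\in H$.
   Context: A subset $X$ of a group $K$ is $4$-large in $K$ if the intersection of any $4$ left translates $a_1X\cap a_2X\cap a_3X\cap a_4X$ ($a_i\in K$) is non-empty. -}

module Defs where

open import Algebra.Bundles using (Group)
import Algebra.Morphism.Construct.Composition as Composition
import Algebra.Morphism.Construct.Identity as Identity
open import Algebra.Morphism.Structures
  using (IsGroupIsomorphism)
open import Data.Fin.Base using (Fin)
open import Data.Nat.Base using (ℕ)
open import Data.Product.Base using (∃; _×_; _,_; proj₁; proj₂)
open import Function.Base using (_∘_)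
open import Function.Bundles using (Inverse)
open import Level using (Level; suc; _⊔_)
open import Relation.Binary.Bundles using (Setoid)
open import Relation.Binary.Definitions using (_Respects_)
open import Relation.Binary.PropositionalEquality.Properties using () renaming (setoid to ≡-setoid)
open import Relation.Unary using (Pred; _∈_; Satisfiable; ⋂)

Finite : ∀ {c ℓ} → Setoid c ℓ → Set (c ⊔ ℓ)
Finite S = ∃ λ n → Inverse S (≡-setoid (Fin n))

record Subgroup {c ℓ} (G : Group c ℓ) (p : Level) : Set (c ⊔ ℓ ⊔ suc p) where
  open Group G
  field
    Member    : Pred Carrier p
    resp      : Member Respects _≈_
    ε-closed  : ε ∈ Member
    ∙-closed  : ∀ {x y} → x ∈ Member → y ∈ Member → x ∙ y ∈ Member
    ⁻¹-closed : ∀ {x} → x ∈ Member → x ⁻¹ ∈ Member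

  -- Elements are compared in G; the membership proofs are ignored.
  group : Group (c ⊔ p) ℓ
  group = record
    { Carrier = ∃ Member
    ; _≈_     = λ x y → proj₁ x ≈ proj₁ y
    ; _∙_     = λ (x , x∈) (y , y∈) → x ∙ y , ∙-closed x∈ y∈
    ; ε       = ε , ε-closed
    ; _⁻¹     = λ (x , x∈) → x ⁻¹ , ⁻¹-closed x∈
    ; isGroup = record
      { isMonoid = record
        { isSemigroup = record
          { isMagma = record
            { isEquivalence = record { refl = refl ; sym = sym ; trans = trans }
            ; ∙-cong        = ∙-cong
            }
          ; assoc = λ (x , _) (y , _) (z , _) → assoc x y z
          }
        ; identity = (λ (x , _) → identityˡ x) , (λ (x , _) → identityʳ x)
        }
      ; inverse = (λ (x , _) → inverseˡ x) , (λ (x , _) → inverseʳ x)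
      ; ⁻¹-cong = ⁻¹-cong
      }
    }

module _ {c ℓ} (G : Group c ℓ) where
  open Group G

  record Automorphism : Set (c ⊔ ℓ) where
    field
      ⟦_⟧                : Carrier → Carrier
      isGroupIsomorphism : IsGroupIsomorphism rawGroup rawGroup ⟦_⟧

    open IsGroupIsomorphism isGroupIsomorphism public
      using (⟦⟧-cong; ∙-homo; ε-homo; ⁻¹-homo; injective; surjective)

    inv : Carrier → Carrier
    inv y = proj₁ (surjective y)

    inv-right : ∀ y → ⟦ inv y ⟧ ≈ y
    inv-right y = proj₂ (surjective y) refl

    inv-left : ∀ x → inv ⟦ x ⟧ ≈ x
    inv-left x = injective (inv-right ⟦ x ⟧)

  open Automorphism using (⟦_⟧; inv; inv-right; inv-left)

  idAut : Automorphism
  idAut = record { isGroupIsomorphism = Identity.isGroupIsomorphism rawGroup refl }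

  _∘Aut_ : Automorphism → Automorphism → Automorphism
  σ ∘Aut τ = record
    { ⟦_⟧ = ⟦ σ ⟧ ∘ ⟦ τ ⟧
    ; isGroupIsomorphism = Composition.isGroupIsomorphism trans
        (Automorphism.isGroupIsomorphism τ) (Automorphism.isGroupIsomorphism σ)
    }

  invAut : Automorphism → Automorphism
  invAut σ = record
    { ⟦_⟧ = inv σ
    ; isGroupIsomorphism = record
      { isGroupMonomorphism = record
        { isGroupHomomorphism = record
          { isMonoidHomomorphism = record
            { isMagmaHomomorphism = record
              { isRelHomomorphism = record
                { cong = λ {x} {y} x≈y →
                    S.injective (trans (inv-right σ x) (trans x≈y (sym (inv-right σ y)))) }
              ; homo = λ x y → S.injective (trans (inv-right σ (x ∙ y))
                  (sym (trans (S.∙-homo (inv σ x) (inv σ y)) (∙-cong (inv-right σ x) (inv-right σ y)))))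
              }
            ; ε-homo = S.injective (trans (inv-right σ ε) (sym S.ε-homo))
            }
          ; ⁻¹-homo = λ x → S.injective (trans (inv-right σ (x ⁻¹))
              (sym (trans (S.⁻¹-homo (inv σ x)) (⁻¹-cong (inv-right σ x)))))
          }
        ; injective = λ {x} {y} eq →
            trans (sym (inv-right σ x)) (trans (S.⟦⟧-cong eq) (inv-right σ y))
        }
      ; surjective = λ x → ⟦ σ ⟧ x , λ {z} z≈σx →
          S.injective (trans (inv-right σ z) z≈σx)
      }
    }
    where module S = Automorphism σ

  Aut : Group (c ⊔ ℓ) (c ⊔ ℓ)
  Aut = record
    { Carrier = Automorphism
    ; _≈_     = λ σ τ → ∀ x → ⟦ σ ⟧ x ≈ ⟦ τ ⟧ x
    ; _∙_     = _∘Aut_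
    ; ε       = idAut
    ; _⁻¹     = invAut
    ; isGroup = record
      { isMonoid = record
        { isSemigroup = record
          { isMagma = record
            { isEquivalence = record
              { refl  = λ _ → refl
              ; sym   = λ p x → sym (p x)
              ; trans = λ p q x → trans (p x) (q x)
              }
            ; ∙-cong = λ {σ} {_} {_} {τ'} p q x →
                trans (Automorphism.⟦⟧-cong σ (q x)) (p (⟦ τ' ⟧ x))
            }
          ; assoc = λ _ _ _ _ → refl
          }
        ; identity = (λ _ _ → refl) , (λ _ _ → refl)
        }
      ; inverse = inv-left , inv-right
      ; ⁻¹-cong = λ {σ} {τ} p x → Automorphism.injective σ
          (trans (inv-right σ x) (trans (sym (inv-right τ x)) (sym (p (inv τ x)))))
      }
    }

  leftTranslate : ∀ {p} → Carrier → Pred Carrier p → Pred Carrier (c ⊔ ℓ ⊔ p)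
  leftTranslate a X x = ∃ λ y → y ∈ X × x ≈ a ∙ y

  Large : ∀ {p} → ℕ → Pred Carrier p → Set (c ⊔ ℓ ⊔ p)
  Large k X = (a : Fin k → Carrier) → Satisfiable (⋂ (Fin k) λ i → leftTranslate (a i) X)

{-# OPTIONS --safe #-}

-- Given τ ∈ Σ and x ∈ H, a common element (σ , g) of the translates by (1 , 1),
-- (τ , 1), (1 , x) and (τ , x) has σ(a⁻¹g) = a⁻¹g = τ(a⁻¹g) for both a = 1 and
-- a = x. So τ fixes g and x⁻¹g, hence also x.
module Submission where

open import Algebra.Bundles using (Group)
open import Algebra.Construct.DirectProduct using () renaming (group to _×ᴳ_)
import Algebra.Properties.Group as GroupProperties
open import Data.Fin.Patterns using (0F; 1F; 2F; 3F)
open import Data.Product.Base using (_,_)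
open import Data.Vec.Functional using (_∷_; [])
import Relation.Binary.Reasoning.Setoid as SetoidReasoning
open import Relation.Unary using (Pred; _∈_)
open import Defs

module _ {c ℓ h s} (G : Group c ℓ) (H : Subgroup G h) (Σ : Subgroup (Aut G) s) where
  open Group G
  open GroupProperties G using (\\-leftDividesˡ; \\-leftDividesʳ; ∙-cancelʳ; ε⁻¹≈ε)
  open Automorphism using (⟦_⟧; ⟦⟧-cong; ∙-homo)
  open SetoidReasoning setoid

  private
    module H = Subgroup H
    module Σ = Subgroup Σ
    ΣH = Σ.group ×ᴳ H.group

  Fixes : Pred (Group.Carrier ΣH) ℓ
  Fixes ((σ , _) , (g , _)) = ⟦ σ ⟧ g ≈ g

  -- Membership writes the point as `(τ ∘ ρ , a ∙ y)` with `ρ` fixing `y`. Hence `y` is `a ⁻¹ ∙ g`,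
  -- and `σ` sends it to the image under `τ` of `ρ y`, which is `y`. For `τ` the identity this says
  -- that `σ` fixes `a ⁻¹ ∙ g`.
  translate⇒agree : ∀ (p@((σ , _) , (g , _)) : Group.Carrier ΣH) τ τ∈ a a∈ →
    p ∈ leftTranslate ΣH ((τ , τ∈) , (a , a∈)) Fixes →
    ⟦ σ ⟧ (a ⁻¹ ∙ g) ≈ ⟦ τ ⟧ (a ⁻¹ ∙ g)
  translate⇒agree ((σ , _) , (g , _)) τ _ a _ (((ρ , _) , (y , _)) , ρy≈y , σ≈τρ , g≈ay) = begin
    ⟦ σ ⟧ (a ⁻¹ ∙ g)  ≈⟨ ⟦⟧-cong σ a⁻¹g≈y ⟩
    ⟦ σ ⟧ y           ≈⟨ σ≈τρ y ⟩
    ⟦ τ ⟧ (⟦ ρ ⟧ y)   ≈⟨ ⟦⟧-cong τ ρy≈y ⟩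
    ⟦ τ ⟧ y           ≈⟨ ⟦⟧-cong τ a⁻¹g≈y ⟨
    ⟦ τ ⟧ (a ⁻¹ ∙ g)  ∎
    where
    a⁻¹g≈y : a ⁻¹ ∙ g ≈ y
    a⁻¹g≈y = trans (∙-congˡ g≈ay) (\\-leftDividesʳ a y)

  -- The fixed points of `τ` form a subgroup. Since `g` is `x ∙ q`, applying `τ` and cancelling `q`
  -- on the right gives the claim without inverting `q`.
  fixed-quotient : ∀ (τ : Automorphism G) {x g} →
    ⟦ τ ⟧ g ≈ g → ⟦ τ ⟧ (x ⁻¹ ∙ g) ≈ x ⁻¹ ∙ g → ⟦ τ ⟧ x ≈ x
  fixed-quotient τ {x} {g} τg≈g τq≈q = ∙-cancelʳ q (⟦ τ ⟧ x) x (begin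
    ⟦ τ ⟧ x ∙ q        ≈⟨ ∙-congˡ τq≈q ⟨
    ⟦ τ ⟧ x ∙ ⟦ τ ⟧ q  ≈⟨ ∙-homo τ x q ⟨
    ⟦ τ ⟧ (x ∙ q)      ≈⟨ ⟦⟧-cong τ (\\-leftDividesˡ x g) ⟩
    ⟦ τ ⟧ g            ≈⟨ τg≈g ⟩
    g                  ≈⟨ \\-leftDividesˡ x g ⟨
    x ∙ q              ∎)
    where q = x ⁻¹ ∙ g

  large⇒fixes : Large ΣH 4 Fixes → ∀ τ → τ ∈ Σ.Member → ∀ x → x ∈ H.Member → ⟦ τ ⟧ x ≈ x
  large⇒fixes large τ τ∈ x x∈
    -- The order matters below: indices 0 and 1 have second coordinate `1H`, indices 2 and 3 have
    -- `x`, and in each pair the first coordinate is `1Σ`, then `τ`.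
    with large ((1Σ , 1H) ∷ ((τ , τ∈) , 1H) ∷ (1Σ , (x , x∈)) ∷ ((τ , τ∈) , (x , x∈)) ∷ [])
    where
    1Σ = Group.ε Σ.group
    1H = Group.ε H.group
  ... | p@((σ , _) , (g , _)) , common = fixed-quotient τ
    -- Here `a` is `ε`, so the factor `ε ⁻¹` has to be inserted and then removed.
    (begin
      ⟦ τ ⟧ g           ≈⟨ ⟦⟧-cong τ ε⁻¹g≈g ⟨
      ⟦ τ ⟧ (ε ⁻¹ ∙ g)  ≈⟨ translate⇒agree p τ τ∈ ε H.ε-closed (common 1F) ⟨
      ⟦ σ ⟧ (ε ⁻¹ ∙ g)  ≈⟨ translate⇒agree p (idAut G) Σ.ε-closed ε H.ε-closed (common 0F) ⟩
      ε ⁻¹ ∙ g          ≈⟨ ε⁻¹g≈g ⟩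
      g                 ∎)
    -- The same comparison through `σ`, now with `a` equal to `x`.
    (begin
      ⟦ τ ⟧ (x ⁻¹ ∙ g)  ≈⟨ translate⇒agree p τ τ∈ x x∈ (common 3F) ⟨
      ⟦ σ ⟧ (x ⁻¹ ∙ g)  ≈⟨ translate⇒agree p (idAut G) Σ.ε-closed x x∈ (common 2F) ⟩
      x ⁻¹ ∙ g          ∎)
    where
    ε⁻¹g≈g : ε ⁻¹ ∙ g ≈ g
    ε⁻¹g≈g = trans (∙-congʳ ε⁻¹≈ε) (identityˡ g)

theorem7p2 :
    ∀ {c ℓ h s} (G : Group c ℓ) → Finite (Group.setoid G) →
    (H : Subgroup G h) → Finite (Group.setoid (Subgroup.group H)) →
    (Σ : Subgroup (Aut G) s) →
    let open Group G using (_≈_)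
        open Automorphism using (⟦_⟧)
    in
    Large (Subgroup.group Σ ×ᴳ Subgroup.group H) 4
      (λ ((σ , _) , (g , _)) → ⟦ σ ⟧ g ≈ g) →
    ∀ σ → σ ∈ Subgroup.Member Σ → ∀ g → g ∈ Subgroup.Member H → ⟦ σ ⟧ g ≈ g
theorem7p2 G _ H _ Σ = large⇒fixes G H Σ
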